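{- Let $G$ be a geometric graph with $n$ vertices that has $\lambda$-low density. Then $G$ has packedness $c \in \mathcal{O}(\lambda\sqrt{n})$. That is, there is an absolute constant $C>0$ such that for every $n$, every $\lambda$, and every geometric graph $G$ with $n$ vertices and $\lambda$-low density, $G$ is $c$-packed for $c = C\lambda\sqrt{n}$.
   Context: A geometric graph is a finite simple undirected graph embedded in the plane: each vertex is associated with a point in $\mathbb{R}^2$, each edge is a straight-line segment between its endpoints and has its Euclidean length; edges may cross. Squares are axis-aligned, and the radius of a square is half its side length. A geometric graph $G$ has $\lambda$-low density if for each square $S$ of radius $r$ (for every $r>0$) there are at most $\lambda$ edges of $G$ that have length greater than $r$ and intersect $S$. A geometric graph $G$ is $c$-packed (has packedness $c$) if for each square $S$ of radius $r$ (for every $r>0$) the total length of the edges of $G$ clipped to $S$ is at most $cr$. Both notions can also be defined with balls of radius $r$ instead of squares; the variants are equivalent up to constant factors. -}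

module Defs where

open import Algebra.Apartness.Bundles using (HeytingCommutativeRing; HeytingField)
open import Algebra.Bundles using (CommutativeRing)
import Algebra.Properties.Semiring.Mult as Mult
open import Data.Fin.Base as Fin using (Fin)
import Data.Fin.Properties as Fin
open import Data.List.Base using (List; allFin; cartesianProduct; filter; foldr; length; map)
open import Data.List.Relation.Binary.Sublist.Propositional using (_⊆_)
open import Data.List.Relation.Unary.All using (All)
open import Data.Nat.Base as ℕ using (ℕ)
open import Data.Product.Base using (∃-syntax; _×_; _,_; proj₁; proj₂)
open import Data.Sum.Base using (_⊎_)
open import Function.Bundles using (_⇔_)
open import Level using (_⊔_; 0ℓ) renaming (suc to lsuc)
open import Relation.Binary.Core using (Rel)
open import Relation.Binary.Definitions using (Decidable; Irreflexive; Symmetric)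
open import Relation.Binary.PropositionalEquality.Core using (_≡_)
open import Relation.Binary.Structures using (IsStrictPartialOrder)
open import Relation.Nullary.Decidable using (_×-dec_)
open import Relation.Nullary.Negation using (¬_)

record OrderedField c ℓ₁ ℓ₂ : Set (lsuc (c ⊔ ℓ₁ ⊔ ℓ₂)) where
  infix 4 _<_
  field
    heytingField : HeytingField c ℓ₁ ℓ₂

  open HeytingField heytingField public

  field
    _<_                  : Rel Carrier ℓ₂
    isStrictPartialOrder : IsStrictPartialOrder _≈_ _<_
    #⇔<⊎>                : ∀ {x y} → x # y ⇔ (x < y ⊎ y < x)
    +-monoˡ-<            : ∀ {x y} z → x < y → x + z < y + z
    *-pos                : ∀ {x y} → 0# < x → 0# < y → 0# < x * y

  infix 4 _≤_
  _≤_ : Rel Carrier ℓ₂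
  x ≤ y = ¬ (y < x)

  open HeytingCommutativeRing heytingCommutativeRing public using (commutativeRing)

  open Mult (CommutativeRing.semiring commutativeRing) using () renaming (_×_ to _·ℕ_)

  fromℕ : ℕ → Carrier
  fromℕ n = n ·ℕ 1#

  IsCauchy : (ℕ → Carrier) → Set (c ⊔ ℓ₂)
  IsCauchy u = ∀ ε → 0# < ε → ∃[ N ] ∀ i j → N ℕ.≤ i → N ℕ.≤ j → u i - u j < ε

  _ConvergesTo_ : (ℕ → Carrier) → Carrier → Set (c ⊔ ℓ₂)
  u ConvergesTo x =
    ∀ ε → 0# < ε → ∃[ N ] ∀ i → N ℕ.≤ i → (u i - x < ε × x - u i < ε)

-- The real numbers, characterised as the Cauchy complete Archimedean ordered
-- field.  The axioms are the constructive ones (the order is not assumed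
-- decidable), so they hold of the Cauchy reals without excluded middle;
-- classically they determine ℝ up to isomorphism.
record Reals c ℓ₁ ℓ₂ : Set (lsuc (c ⊔ ℓ₁ ⊔ ℓ₂)) where
  field
    orderedField : OrderedField c ℓ₁ ℓ₂

  open OrderedField orderedField public

  -- Square roots exist by completeness; they are included so as to have a
  -- function.  Nothing is said about its values at negative arguments, where
  -- √ x can be taken to be the square root of max(x, 0).
  field
    archimedean : ∀ x → ∃[ n ] x < fromℕ n
    complete    : ∀ u → IsCauchy u → ∃[ x ] u ConvergesTo x
    √           : Carrier → Carrier
    √-nonNeg    : ∀ {x} → 0# ≤ x → 0# ≤ √ x
    √-squared   : ∀ {x} → 0# ≤ x → √ x * √ x ≈ x

record SimpleGraph (n : ℕ) : Set₁ where
  field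
    Adj        : Rel (Fin n) 0ℓ
    adj?       : Decidable Adj
    adj-sym    : Symmetric Adj
    adj-irrefl : Irreflexive _≡_ Adj

  -- Each undirected edge occurs exactly once, as the pair (i , j) with i < j.
  edges : List (Fin n × Fin n)
  edges = filter (λ (i , j) → (i Fin.<? j) ×-dec adj? i j)
                 (cartesianProduct (allFin n) (allFin n))

module Plane {c ℓ₁ ℓ₂} (R : Reals c ℓ₁ ℓ₂) where

  open Reals R

  Point : Set c
  Point = Carrier × Carrier

  dist : Point → Point → Carrier
  dist (x₁ , y₁) (x₂ , y₂) =
    √ ((x₁ - x₂) * (x₁ - x₂) + (y₁ - y₂) * (y₁ - y₂))

  record Segment : Set c where
    constructor [_,_]
    field
      start end : Point

  len : Segment → Carrier
  len [ p , q ] = dist p q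

  infix 4 _∈ₗ_ _∈ₛ_

  _∈ₗ_ : Point → Segment → Set (c ⊔ ℓ₁ ⊔ ℓ₂)
  (x , y) ∈ₗ [ (x₁ , y₁) , (x₂ , y₂) ] =
    ∃[ t ] (0# ≤ t × t ≤ 1#) ×
           (x ≈ x₁ + t * (x₂ - x₁) × y ≈ y₁ + t * (y₂ - y₁))

  record Square : Set (c ⊔ ℓ₂) where
    field
      centre     : Point
      radius     : Carrier
      radius-pos : 0# < radius

  open Square public

  _∈ₛ_ : Point → Square → Set ℓ₂
  (x , y) ∈ₛ S =
    (a - radius S ≤ x × x ≤ a + radius S) ×
    (b - radius S ≤ y × y ≤ b + radius S)
    where
    a = proj₁ (centre S)
    b = proj₂ (centre S)

  _Intersects_ : Segment → Square → Set (c ⊔ ℓ₁ ⊔ ℓ₂)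
  s Intersects S = ∃[ p ] (p ∈ₗ s × p ∈ₛ S)

  -- ClippedLength s S ℓ: the length of s ∩ S is ℓ.  By convexity s ∩ S is
  -- either empty or a (possibly degenerate) segment.
  data ClippedLength (s : Segment) (S : Square) (ℓ : Carrier) : Set (c ⊔ ℓ₁ ⊔ ℓ₂) where
    disjoint : ¬ (s Intersects S) → ℓ ≈ 0# → ClippedLength s S ℓ
    clipped  : ∀ s′ → (∀ p → (p ∈ₗ s′) ⇔ (p ∈ₗ s × p ∈ₛ S)) → ℓ ≈ len s′ →
               ClippedLength s S ℓ

  record GeometricGraph (n : ℕ) : Set (lsuc 0ℓ ⊔ c) where
    field
      graph    : SimpleGraph n
      position : Fin n → Point

    open SimpleGraph graph public

    segment : Fin n × Fin n → Segment
    segment (i , j) = [ position i , position j ]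

  module _ {n : ℕ} (G : GeometricGraph n) where

    open GeometricGraph G

    -- As edges has no repetitions, its sublists are the sets of edges of G.
    LowDensity : Carrier → Set (c ⊔ ℓ₁ ⊔ ℓ₂)
    LowDensity d =
      ∀ (S : Square) (es : List (Fin n × Fin n)) → es ⊆ edges →
      All (λ e → radius S < len (segment e) × segment e Intersects S) es →
      fromℕ (length es) ≤ d

    -- Clipped lengths are unique up to _≈_.  Their existence needs case
    -- distinctions on the order, so it holds only up to double negation unless
    -- the order is decidable; since _≤_ is a negation, the bound below is
    -- nevertheless as strong as with an explicit choice of the lengths.
    Packed : Carrier → Set (c ⊔ ℓ₁ ⊔ ℓ₂)
    Packed k =
      ∀ (S : Square) (ℓ : Fin n × Fin n → Carrier) →
      All (λ e → ClippedLength (segment e) S (ℓ e)) edges →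
      foldr _+_ 0# (map ℓ edges) ≤ k * radius S

{-# OPTIONS --safe #-}
module Submission where

-- Let S have radius r, let m be about √n, and cut S into m × m cells of radius
-- ρ = r / m.  An edge longer than ρ of clipped length ℓ meets a set of grid
-- columns covering its x-extent and a set of grid rows covering its y-extent, so
-- ℓ is at most 4ρ times the number of cells it meets.  As each cell is met by at
-- most λ such edges, these edges contribute at most 4ρλm² = 4λmr.  An edge of
-- positive length at most ρ contributes at most ρ, and there are at most λn of
-- these: a sufficiently small square around a vertex meets all the edges of
-- positive length at that vertex, so every vertex has at most λ of them.
--
-- Since _≤_ is a negation, case distinctions are available whenever an
-- inequality _≤_ is to be proved.

open import Defs
open import Algebra.Bundles using (CommutativeRing)
import Algebra.Properties.CommutativeMonoid.Sum as Sum
import Algebra.Properties.Ring as RingProperties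
import Algebra.Properties.Semiring.Mult as Mult
import Algebra.Properties.Semiring.Mult.TCOptimised as Mult′
import Algebra.Solver.Ring as RingSolver
open import Algebra.Solver.Ring.AlmostCommutativeRing
  using (fromCommutativeRing; _-Raw-AlmostCommutative⟶_)
open import Data.Bool.Base using (if_then_else_)
open import Data.Empty using (⊥-elim)
open import Data.Fin.Base using (Fin; zero; suc; toℕ)
import Data.Fin.Properties as Fin
open import Data.Integer.Base as ℤ using (ℤ; +_; -[1+_]; _⊖_)
import Data.Integer.Properties as ℤ
open import Data.List.Base using (List; []; _∷_; filter; foldr; length; map)
open import Data.List.Relation.Binary.Sublist.Propositional using (minimum)
open import Data.List.Relation.Binary.Sublist.Propositional.Properties using (filter-⊆)
open import Data.List.Relation.Unary.All as All using (All; []; _∷_)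
import Data.List.Relation.Unary.All.Properties as All
open import Data.Maybe.Base using (Maybe; just; nothing)
open import Data.Nat.Base as ℕ using (ℕ; zero; suc)
import Data.Nat.Properties as ℕ
open import Data.Product.Base using (∃-syntax; _×_; _,_; proj₁; proj₂; swap)
open import Data.Sum.Base using (_⊎_; inj₁; inj₂; [_,_]′)
open import Effect.Monad using (RawMonad)
open import Function.Bundles using (module Equivalence)
open import Level using (_⊔_)
import Relation.Binary.PropositionalEquality.Core as ≡
import Relation.Binary.Reasoning.Base.Triple as Triple
import Relation.Binary.Reasoning.Setoid as SetoidReasoning
open import Relation.Binary.Structures using (IsPreorder; IsStrictPartialOrder)
open import Relation.Nullary.Decidable.Core using (Dec; does; yes; no; ¬¬-excluded-middle)
open import Relation.Nullary.Negation using (¬_; ¬¬-map; ¬¬-Monad)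

-- Solving ring equations with integer coefficients.

module IntegerCoefficients {c ℓ} (R : CommutativeRing c ℓ) where

  open CommutativeRing R
  open RingProperties ring
    using (-0#≈0#; -‿involutive; -‿distribˡ-*; -‿distribʳ-*; -‿+-comm)
  open Mult′ semiring renaming (_×_ to _·_)
  open SetoidReasoning setoid

  -- With the optimised multiple, `fromℤ (+ 1)` reduces to `1#` itself, so `con (+ 1)` stands for a
  -- literal `1#` in solved equations.
  fromℤ : ℤ → Carrier
  fromℤ (+ n)    = n · 1#
  fromℤ -[1+ n ] = - (suc n · 1#)

  cancel-1+ : ∀ x y → (1# + x) - (1# + y) ≈ x - y
  cancel-1+ x y = begin
    (1# + x) - (1# + y)      ≈⟨ +-congˡ (-‿+-comm 1# y) ⟨
    (1# + x) + (- 1# + - y)  ≈⟨ +-congʳ (+-comm 1# x) ⟩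
    (x + 1#) + (- 1# + - y)  ≈⟨ +-assoc x 1# _ ⟩
    x + (1# + (- 1# + - y))  ≈⟨ +-congˡ (+-assoc 1# (- 1#) (- y)) ⟨
    x + ((1# - 1#) + - y)    ≈⟨ +-congˡ (+-congʳ (-‿inverseʳ 1#)) ⟩
    x + (0# + - y)           ≈⟨ +-congˡ (+-identityˡ (- y)) ⟩
    x - y                    ∎

  fromℤ-neg : ∀ i → fromℤ (ℤ.- i) ≈ - fromℤ i
  fromℤ-neg (+ zero)  = sym -0#≈0#
  fromℤ-neg (+ suc n) = refl
  fromℤ-neg -[1+ n ]  = sym (-‿involutive _)

  fromℤ-⊖ : ∀ m n → fromℤ (m ⊖ n) ≈ m · 1# - n · 1#
  fromℤ-⊖ m zero = begin
    m · 1#         ≈⟨ +-identityʳ _ ⟨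
    m · 1# + 0#    ≈⟨ +-congˡ -0#≈0# ⟨
    m · 1# - 0#    ∎
  fromℤ-⊖ zero (suc n) = sym (+-identityˡ _)
  fromℤ-⊖ (suc m) (suc n) = begin
    fromℤ (suc m ⊖ suc n)          ≡⟨ ≡.cong fromℤ (ℤ.[1+m]⊖[1+n]≡m⊖n m n) ⟩
    fromℤ (m ⊖ n)                  ≈⟨ fromℤ-⊖ m n ⟩
    m · 1# - n · 1#                ≈⟨ cancel-1+ _ _ ⟨
    (1# + m · 1#) - (1# + n · 1#)
      ≈⟨ +-cong (1+× m 1#) (-‿cong (1+× n 1#)) ⟨
    suc m · 1# - suc n · 1#        ∎

  fromℤ-+ : ∀ i j → fromℤ (i ℤ.+ j) ≈ fromℤ i + fromℤ j
  fromℤ-+ (+ m)    (+ n)    = ×-homo-+ 1# m n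
  fromℤ-+ (+ m)    -[1+ n ] = fromℤ-⊖ m (suc n)
  fromℤ-+ -[1+ m ] (+ n)    = trans (fromℤ-⊖ n (suc m)) (+-comm _ _)
  fromℤ-+ -[1+ m ] -[1+ n ] = begin
    - (suc (suc (m ℕ.+ n)) · 1#)       ≡⟨ ≡.cong (λ k → - (suc k · 1#)) (ℕ.+-suc m n) ⟨
    - ((suc m ℕ.+ suc n) · 1#)         ≈⟨ -‿cong (×-homo-+ 1# (suc m) (suc n)) ⟩
    - (suc m · 1# + suc n · 1#)        ≈⟨ -‿+-comm _ _ ⟨
    - (suc m · 1#) + - (suc n · 1#)    ∎

  fromℤ-*-+ : ∀ m j → fromℤ (+ m ℤ.* j) ≈ m · 1# * fromℤ j
  fromℤ-*-+ m (+ n) = begin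
    fromℤ (+ m ℤ.* + n)  ≡⟨ ≡.cong fromℤ (ℤ.pos-* m n) ⟨
    (m ℕ.* n) · 1#       ≈⟨ ×1-homo-* m n ⟩
    m · 1# * n · 1#      ∎
  fromℤ-*-+ m -[1+ n ] = begin
    fromℤ (+ m ℤ.* ℤ.- (+ suc n))   ≡⟨ ≡.cong fromℤ (ℤ.neg-distribʳ-* (+ m) (+ suc n)) ⟨
    fromℤ (ℤ.- (+ m ℤ.* + suc n))   ≈⟨ fromℤ-neg (+ m ℤ.* + suc n) ⟩
    - fromℤ (+ m ℤ.* + suc n)       ≈⟨ -‿cong (fromℤ-*-+ m (+ suc n)) ⟩
    - (m · 1# * suc n · 1#)         ≈⟨ -‿distribʳ-* _ _ ⟩
    m · 1# * - (suc n · 1#)         ∎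

  fromℤ-* : ∀ i j → fromℤ (i ℤ.* j) ≈ fromℤ i * fromℤ j
  fromℤ-* (+ m)    j = fromℤ-*-+ m j
  fromℤ-* -[1+ m ] j = begin
    fromℤ (ℤ.- (+ suc m) ℤ.* j)    ≡⟨ ≡.cong fromℤ (ℤ.neg-distribˡ-* (+ suc m) j) ⟨
    fromℤ (ℤ.- (+ suc m ℤ.* j))    ≈⟨ fromℤ-neg (+ suc m ℤ.* j) ⟩
    - fromℤ (+ suc m ℤ.* j)        ≈⟨ -‿cong (fromℤ-*-+ (suc m) j) ⟩
    - (suc m · 1# * fromℤ j)       ≈⟨ -‿distribˡ-* _ _ ⟩
    - (suc m · 1#) * fromℤ j       ∎

  coefficients : ℤ.+-*-rawRing -Raw-AlmostCommutative⟶ fromCommutativeRing R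
  coefficients = record
    { ⟦_⟧    = fromℤ
    ; +-homo = fromℤ-+
    ; *-homo = fromℤ-*
    ; -‿homo = fromℤ-neg
    ; 0-homo = refl
    ; 1-homo = refl
    }

  -- Equality in the ring is not assumed decidable, so coefficients are compared as integers.
  -- Distinct integers may have equal images; answering `nothing` for them is sound.
  _≟fromℤ_ : ∀ i j → Maybe (fromℤ i ≈ fromℤ j)
  i ≟fromℤ j with i ℤ.≟ j
  ... | yes i≡j = just (reflexive (≡.cong fromℤ i≡j))
  ... | no  _   = nothing

  open RingSolver ℤ.+-*-rawRing (fromCommutativeRing R) coefficients _≟fromℤ_ public
    using (solve; _:=_; _:+_; _:*_; _:-_; :-_; con)

-- Order and arithmetic in a constructive ordered field.

module OrderedFieldProperties {c ℓ₁ ℓ₂} (F : OrderedField c ℓ₁ ℓ₂) where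

  open OrderedField F hiding (zero)
  open IsStrictPartialOrder isStrictPartialOrder public
    using (<-resp-≈)
    renaming (irrefl to <-irrefl; trans to <-trans; asym to <-asym)
  open IntegerCoefficients commutativeRing public
  open CommutativeRing commutativeRing using (semiring; +-commutativeMonoid)

  ≤-stable : ∀ {a} {P : Set a} {x y} → ¬ ¬ P → (P → x ≤ y) → x ≤ y
  ≤-stable ¬¬p f y<x = ¬¬p (λ p → f p y<x)

  -- Given `y < x`, the first branch refutes `P`, and this refutation is the premise of the second
  -- branch. No decision of `P` is made.
  ≤-cases : ∀ {a} (P : Set a) {x y} → (P → x ≤ y) → (¬ P → x ≤ y) → x ≤ y
  ≤-cases P f g y<x = g (λ p → f p y<x) y<x

  <⇒≤ : ∀ {x y} → x < y → x ≤ y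
  <⇒≤ x<y y<x = <-asym x<y y<x

  -- Apartness is cotransitive. Where it puts `z` below `x` or above `y`, transitivity through that
  -- endpoint gives the comparison with the other one.
  <-cotrans : ∀ {x y} → x < y → ∀ z → x < z ⊎ z < y
  <-cotrans x<y z with #-cotrans (Equivalence.from #⇔<⊎> (inj₁ x<y)) z
  ... | inj₁ x#z with Equivalence.to #⇔<⊎> x#z
  ...   | inj₁ x<z = inj₁ x<z
  ...   | inj₂ z<x = inj₂ (<-trans z<x x<y)
  <-cotrans x<y z | inj₂ z#y with Equivalence.to #⇔<⊎> z#y
  ...   | inj₁ z<y = inj₂ z<y
  ...   | inj₂ y<z = inj₁ (<-trans x<y y<z)

  <-≤-trans : ∀ {x y z} → x < y → y ≤ z → x < z
  <-≤-trans {z = z} x<y y≤z with <-cotrans x<y z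
  ... | inj₁ x<z = x<z
  ... | inj₂ z<y = ⊥-elim (y≤z z<y)

  ≤-<-trans : ∀ {x y z} → x ≤ y → y < z → x < z
  ≤-<-trans {x} x≤y y<z with <-cotrans y<z x
  ... | inj₁ y<x = ⊥-elim (x≤y y<x)
  ... | inj₂ x<z = x<z

  ≤-isPreorder : IsPreorder _≈_ _≤_
  ≤-isPreorder = record
    { isEquivalence = isEquivalence
    ; reflexive     = λ x≈y y<x → <-irrefl (sym x≈y) y<x
    ; trans         = λ x≤y y≤z z<x → y≤z (<-≤-trans z<x x≤y)
    }

  open IsPreorder ≤-isPreorder public
    using ()
    renaming (refl to ≤-refl; reflexive to ≤-reflexive; trans to ≤-trans)

  module ≤-Reasoning = Triple ≤-isPreorder <-asym <-trans <-resp-≈ <⇒≤ <-≤-trans ≤-<-trans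

  -- If `x < y` fails, then `x ≤ y` rules out both forms of apartness, and tightness yields `x ≈ y`.
  ≤-splitEq : ∀ {x y a b} → x ≤ y → (x < y → a ≤ b) → (x ≈ y → a ≤ b) → a ≤ b
  ≤-splitEq {x} {y} x≤y f g = ≤-cases (x < y) f λ x≮y →
    g (proj₁ (tight x y) λ x#y → [ x≮y , x≤y ]′ (Equivalence.to #⇔<⊎> x#y))

  ≤-total : ∀ x y {a b} → (x ≤ y → a ≤ b) → (y ≤ x → a ≤ b) → a ≤ b
  ≤-total x y f g = ≤-cases (x < y) (λ x<y → f (<⇒≤ x<y)) g

  +-cancelʳ-< : ∀ {x y} z → x + z < y + z → x < y
  +-cancelʳ-< {x} {y} z lt = proj₁ <-resp-≈ (undo y) (proj₂ <-resp-≈ (undo x) (+-monoˡ-< (- z) lt))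
    where
    undo : ∀ x → x + z - z ≈ x
    undo x = solve 2 (λ x z → x :+ z :- z := x) refl x z

  +-monoˡ-≤ : ∀ {x y} z → x ≤ y → x + z ≤ y + z
  +-monoˡ-≤ z x≤y lt = x≤y (+-cancelʳ-< z lt)

  +-mono-≤ : ∀ {x y u v} → x ≤ y → u ≤ v → x + u ≤ y + v
  +-mono-≤ {x} {y} {u} {v} x≤y u≤v = begin
    x + u  ≤⟨ +-monoˡ-≤ u x≤y ⟩
    y + u  ≈⟨ +-comm y u ⟩
    u + y  ≤⟨ +-monoˡ-≤ y u≤v ⟩
    v + y  ≈⟨ +-comm v y ⟩
    y + v  ∎
    where open ≤-Reasoning

  x≤y⇒0≤y-x : ∀ {x y} → x ≤ y → 0# ≤ y - x
  x≤y⇒0≤y-x {x} {y} x≤y = begin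
    0#     ≈⟨ -‿inverseʳ x ⟨
    x - x  ≤⟨ +-monoˡ-≤ (- x) x≤y ⟩
    y - x  ∎
    where open ≤-Reasoning

  x<y⇒0<y-x : ∀ {x y} → x < y → 0# < y - x
  x<y⇒0<y-x {x} x<y = proj₂ <-resp-≈ (-‿inverseʳ x) (+-monoˡ-< (- x) x<y)

  0≤y-x⇒x≤y : ∀ {x y} → 0# ≤ y - x → x ≤ y
  0≤y-x⇒x≤y 0≤y-x y<x = <-irrefl (solve 2 (λ x y → con (+ 0) := (y :- x) :+ (x :- y)) refl _ _)
    (begin-strict
      0#                 <⟨ x<y⇒0<y-x y<x ⟩
      _ - _              ≈⟨ +-identityˡ _ ⟨
      0# + (_ - _)       ≤⟨ +-monoˡ-≤ _ 0≤y-x ⟩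
      (_ - _) + (_ - _)  ∎)
    where open ≤-Reasoning

  +-nonNeg : ∀ {x y} → 0# ≤ x → 0# ≤ y → 0# ≤ x + y
  +-nonNeg 0≤x 0≤y = ≤-trans (≤-reflexive (sym (+-identityˡ 0#))) (+-mono-≤ 0≤x 0≤y)

  *-nonNeg : ∀ {x y} → 0# ≤ x → 0# ≤ y → 0# ≤ x * y
  *-nonNeg {x} {y} 0≤x 0≤y = ≤-splitEq 0≤x
    (λ 0<x → ≤-splitEq 0≤y
      (λ 0<y → <⇒≤ (*-pos 0<x 0<y))
      (λ 0≈y → ≤-reflexive (trans (sym (zeroʳ x)) (*-congˡ 0≈y))))
    (λ 0≈x → ≤-reflexive (trans (sym (zeroˡ y)) (*-congʳ 0≈x)))

  *-monoʳ-≤ : ∀ {x y} z → 0# ≤ z → x ≤ y → z * x ≤ z * y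
  *-monoʳ-≤ {x} {y} z 0≤z x≤y = 0≤y-x⇒x≤y (begin
    0#             ≤⟨ *-nonNeg 0≤z (x≤y⇒0≤y-x x≤y) ⟩
    z * (y - x)    ≈⟨ solve 3 (λ x y z → z :* (y :- x) := z :* y :- z :* x) refl x y z ⟩
    z * y - z * x  ∎)
    where open ≤-Reasoning

  *-monoˡ-≤ : ∀ {x y} z → 0# ≤ z → x ≤ y → x * z ≤ y * z
  *-monoˡ-≤ {x} {y} z 0≤z x≤y = begin
    x * z  ≈⟨ *-comm x z ⟩
    z * x  ≤⟨ *-monoʳ-≤ z 0≤z x≤y ⟩
    z * y  ≈⟨ *-comm z y ⟩
    y * z  ∎
    where open ≤-Reasoning

  -- The two hypotheses together say |x| ≤ y. They make both factors of y² - x² = (y - x)(y + x)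
  -- nonnegative.
  square-mono : ∀ {x y} → x ≤ y → - x ≤ y → x * x ≤ y * y
  square-mono {x} {y} x≤y -x≤y = 0≤y-x⇒x≤y (begin
    0#                   ≤⟨ *-nonNeg (x≤y⇒0≤y-x x≤y) (x≤y⇒0≤y-x -x≤y) ⟩
    (y - x) * (y - - x)
      ≈⟨ solve 2 (λ x y → (y :- x) :* (y :- :- x) := y :* y :- x :* x) refl x y ⟩
    y * y - x * x        ∎)
    where open ≤-Reasoning

  square-nonNeg : ∀ x → 0# ≤ x * x
  square-nonNeg x = ≤-total 0# x
    (λ 0≤x → *-nonNeg 0≤x 0≤x)
    (λ x≤0 → begin
      0#                    ≤⟨ *-nonNeg (x≤y⇒0≤y-x x≤0) (x≤y⇒0≤y-x x≤0) ⟩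
      (0# - x) * (0# - x)
        ≈⟨ solve 1 (λ x → (con (+ 0) :- x) :* (con (+ 0) :- x) := x :* x) refl x ⟩
      x * x                 ∎)
    where open ≤-Reasoning

  square-cancel : ∀ {x y} → 0# ≤ y → x * x ≤ y * y → x ≤ y
  square-cancel {x} {y} 0≤y x²≤y² y<x = x²≤y² (+-cancelʳ-< (- (y * y)) (begin-strict
    y * y - y * y      ≈⟨ -‿inverseʳ _ ⟩
    0#                 <⟨ *-pos (x<y⇒0<y-x y<x) 0<x+y ⟩
    (x - y) * (x + y)
      ≈⟨ solve 2 (λ x y → (x :- y) :* (x :+ y) := x :* x :- y :* y) refl x y ⟩
    x * x - y * y      ∎))
    where
    open ≤-Reasoning
    0<x+y : 0# < x + y
    0<x+y = begin-strict
      0#      ≤⟨ 0≤y ⟩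
      y       <⟨ y<x ⟩
      x       ≈⟨ +-identityˡ x ⟨
      0# + x  ≤⟨ +-monoˡ-≤ x 0≤y ⟩
      y + x   ≈⟨ +-comm y x ⟩
      x + y   ∎

  inverse : ∀ {x} → 0# < x → ∃[ x⁻¹ ] 0# < x⁻¹ × x * x⁻¹ ≈ 1#
  inverse {x} 0<x = x⁻¹ , 0<x⁻¹ , xx⁻¹≈1
    where
    -- In a Heyting field, apartness of `x` and `0#` is tied to invertibility of the difference
    -- `x - 0#`, so the `0#` has to be removed.
    x-0≈x : x - 0# ≈ x
    x-0≈x = solve 1 (λ x → x :- con (+ 0) := x) refl x
    x-0-invertible = #⇒invertible (Equivalence.from #⇔<⊎> (inj₂ 0<x))
    x⁻¹ : Carrier
    x⁻¹ = proj₁ x-0-invertible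
    xx⁻¹≈1 : x * x⁻¹ ≈ 1#
    xx⁻¹≈1 = trans (*-congʳ (sym x-0≈x)) (proj₂ (proj₂ x-0-invertible))
    y-0≈y : x⁻¹ - 0# ≈ x⁻¹
    y-0≈y = solve 1 (λ x → x :- con (+ 0) := x) refl x⁻¹
    x⁻¹#0 : x⁻¹ # 0#
    x⁻¹#0 = invertible⇒# (x , trans (*-congˡ y-0≈y) xx⁻¹≈1
                            , trans (*-congʳ y-0≈y) (trans (*-comm x⁻¹ x) xx⁻¹≈1))
    0<x⁻¹ : 0# < x⁻¹
    0<x⁻¹ with Equivalence.to #⇔<⊎> x⁻¹#0
    ... | inj₂ 0<x⁻¹ = 0<x⁻¹
    -- A negative inverse makes `x * (0# - x⁻¹)` positive. Adding the nonnegative square `1# * 1#`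
    -- gives `1# - x * x⁻¹`, which is zero.
    ... | inj₁ x⁻¹<0 = ⊥-elim (<-irrefl refl (begin-strict
      0#                        <⟨ *-pos 0<x (x<y⇒0<y-x x⁻¹<0) ⟩
      x * (0# - x⁻¹)            ≈⟨ +-identityˡ _ ⟨
      0# + x * (0# - x⁻¹)       ≤⟨ +-monoˡ-≤ _ (square-nonNeg 1#) ⟩
      1# * 1# + x * (0# - x⁻¹)
        ≈⟨ solve 2 (λ x y → con (+ 1) :* con (+ 1) :+ x :* (con (+ 0) :- y)
                         := con (+ 1) :- x :* y) refl x x⁻¹ ⟩
      1# - x * x⁻¹              ≈⟨ x≈y⇒x-y≈0 (sym xx⁻¹≈1) ⟩
      0#                        ∎))
      where
      open ≤-Reasoning
      x≈y⇒x-y≈0 : ∀ {x y} → x ≈ y → x - y ≈ 0#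
      x≈y⇒x-y≈0 x≈y = trans (+-congʳ x≈y) (-‿inverseʳ _)

  0≤1 : 0# ≤ 1#
  0≤1 = ≤-trans (square-nonNeg 1#) (≤-reflexive (*-identityˡ 1#))

  0<1 : 0# < 1#
  0<1 with Equivalence.to #⇔<⊎> 1#0
    where
    1-0≈1 : 1# - 0# ≈ 1#
    1-0≈1 = solve 0 (con (+ 1) :- con (+ 0) := con (+ 1)) refl
    1-0*1≈1 : (1# - 0#) * 1# ≈ 1#
    1-0*1≈1 = trans (*-identityʳ _) 1-0≈1
    1#0 : 1# # 0#
    1#0 = invertible⇒# (1# , trans (*-comm 1# _) 1-0*1≈1 , 1-0*1≈1)
  ... | inj₁ 1<0 = ⊥-elim (0≤1 1<0)
  ... | inj₂ 0<1 = 0<1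

  +-pos : ∀ {x y} → 0# < x → 0# ≤ y → 0# < x + y
  +-pos {x} {y} 0<x 0≤y = begin-strict
    0#      ≤⟨ 0≤y ⟩
    y       ≈⟨ +-identityˡ y ⟨
    0# + y  <⟨ +-monoˡ-< y 0<x ⟩
    x + y   ∎
    where open ≤-Reasoning

  smaller-positive : ∀ {x} → 0# < x → ∃[ y ] 0# < y × y < x
  smaller-positive {x} 0<x = halve (inverse (+-pos 0<1 0≤1))
    where
    open ≤-Reasoning
    halve : ∃[ ½ ] 0# < ½ × (1# + 1#) * ½ ≈ 1# → ∃[ y ] 0# < y × y < x
    halve (½ , 0<½ , 2*½≈1) = x * ½ , *-pos 0<x 0<½ , (begin-strict
      x * ½                ≈⟨ +-identityˡ _ ⟨
      0# + x * ½           <⟨ +-monoˡ-< _ (*-pos 0<x 0<½) ⟩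
      x * ½ + x * ½
        ≈⟨ solve 2 (λ x h → x :* h :+ x :* h := x :* ((con (+ 1) :+ con (+ 1)) :* h)) refl x ½ ⟩
      x * ((1# + 1#) * ½)  ≈⟨ *-congˡ 2*½≈1 ⟩
      x * 1#               ≈⟨ *-identityʳ x ⟩
      x                    ∎)

  fromℕ-nonNeg : ∀ n → 0# ≤ fromℕ n
  fromℕ-nonNeg zero    = ≤-refl
  fromℕ-nonNeg (suc n) = +-nonNeg 0≤1 (fromℕ-nonNeg n)

  fromℕ-mono-≤ : ∀ {m n} → m ℕ.≤ n → fromℕ m ≤ fromℕ n
  fromℕ-mono-≤ {n = n} ℕ.z≤n = fromℕ-nonNeg n
  fromℕ-mono-≤ (ℕ.s≤s m≤n)   = +-mono-≤ ≤-refl (fromℕ-mono-≤ m≤n)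

  fromℕ-* : ∀ m n → fromℕ (m ℕ.* n) ≈ fromℕ m * fromℕ n
  fromℕ-* = Mult.×1-homo-* semiring

  -- Finite sums, counting by weights, and finite minima.

  open Sum (+-commutativeMonoid) public
    using (sum; ∑-comm)

  sum-nonNeg : ∀ {k} (f : Fin k → Carrier) → (∀ i → 0# ≤ f i) → 0# ≤ sum f
  sum-nonNeg {zero}  f 0≤f = ≤-refl
  sum-nonNeg {suc k} f 0≤f = +-nonNeg (0≤f zero) (sum-nonNeg (λ i → f (suc i)) (λ i → 0≤f (suc i)))

  sum-≤ : ∀ {k} (f : Fin k → Carrier) {x} → (∀ i → f i ≤ x) → sum f ≤ fromℕ k * x
  sum-≤ {zero}  f {x} f≤x = ≤-reflexive (sym (zeroˡ x))
  sum-≤ {suc k} f {x} f≤x = begin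
    f zero + sum (λ i → f (suc i))
      ≤⟨ +-mono-≤ (f≤x zero) (sum-≤ (λ i → f (suc i)) (λ i → f≤x (suc i))) ⟩
    x + fromℕ k * x
      ≈⟨ solve 2 (λ x k → x :+ k :* x := (con (+ 1) :+ k) :* x) refl x (fromℕ k) ⟩
    (1# + fromℕ k) * x  ∎
    where open ≤-Reasoning

  x≤x+y : ∀ {x y} → 0# ≤ y → x ≤ x + y
  x≤x+y {x} 0≤y = ≤-trans (≤-reflexive (sym (+-identityʳ x))) (+-mono-≤ ≤-refl 0≤y)

  y≤x+y : ∀ {x y} → 0# ≤ x → y ≤ x + y
  y≤x+y 0≤x = ≤-trans (x≤x+y 0≤x) (≤-reflexive (+-comm _ _))

  term≤sum : ∀ {k} (f : Fin k → Carrier) → (∀ i → 0# ≤ f i) → ∀ i → f i ≤ sum f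
  term≤sum f 0≤f zero    = x≤x+y (sum-nonNeg (λ i → f (suc i)) (λ i → 0≤f (suc i)))
  term≤sum f 0≤f (suc i) =
    ≤-trans (term≤sum (λ i → f (suc i)) (λ i → 0≤f (suc i)) i) (y≤x+y (0≤f zero))

  module _ {a} {A : Set a} where

    sumᴸ : (A → Carrier) → List A → Carrier
    sumᴸ f xs = foldr _+_ 0# (map f xs)

    sumᴸ-mono : ∀ {f g} {xs} → All (λ x → f x ≤ g x) xs → sumᴸ f xs ≤ sumᴸ g xs
    sumᴸ-mono []            = ≤-refl
    sumᴸ-mono (fx≤gx ∷ f≤g) = +-mono-≤ fx≤gx (sumᴸ-mono f≤g)

    sumᴸ-+ : ∀ f g xs → sumᴸ (λ x → f x + g x) xs ≈ sumᴸ f xs + sumᴸ g xs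
    sumᴸ-+ f g []       = sym (+-identityˡ 0#)
    sumᴸ-+ f g (x ∷ xs) = trans (+-congˡ (sumᴸ-+ f g xs))
      (solve 4 (λ a b c d → (a :+ b) :+ (c :+ d) := (a :+ c) :+ (b :+ d)) refl
        (f x) (g x) (sumᴸ f xs) (sumᴸ g xs))

    sumᴸ-0 : ∀ xs → sumᴸ (λ _ → 0#) xs ≈ 0#
    sumᴸ-0 []       = refl
    sumᴸ-0 (x ∷ xs) = trans (+-identityˡ _) (sumᴸ-0 xs)

    -- The exchange behind the double counting: what is charged edge by edge is added up cell by
    -- cell or vertex by vertex.
    sumᴸ-sum : ∀ {k} (f : Fin k → A → Carrier) xs →
               sumᴸ (λ x → sum (λ i → f i x)) xs ≈ sum (λ i → sumᴸ (f i) xs)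
    sumᴸ-sum {zero}  f xs = sumᴸ-0 xs
    sumᴸ-sum {suc k} f xs = trans
      (sumᴸ-+ (f zero) (λ x → sum (λ i → f (suc i) x)) xs)
      (+-congˡ (sumᴸ-sum (λ i → f (suc i)) xs))

  weight : ∀ {p} {P : Set p} → Dec P → Carrier → Carrier
  weight P? w = if does P? then w else 0#

  weight-nonNeg : ∀ {p} {P : Set p} (P? : Dec P) {w} → 0# ≤ w → 0# ≤ weight P? w
  weight-nonNeg (yes _) 0≤w = 0≤w
  weight-nonNeg (no  _) _   = ≤-refl

  weight-true : ∀ {p} {P : Set p} (P? : Dec P) {w} → P → w ≤ weight P? w
  weight-true (yes _) _ = ≤-refl
  weight-true (no ¬p) p = ⊥-elim (¬p p)

  -- Counting through `filter` produces a sublist, the form in which `LowDensity` takes its sets of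
  -- edges.
  sumᴸ-weight : ∀ {a p} {A : Set a} {P : A → Set p} (P? : ∀ x → Dec (P x)) w xs →
                sumᴸ (λ x → weight (P? x) w) xs ≈ fromℕ (length (filter P? xs)) * w
  sumᴸ-weight P? w [] = sym (zeroˡ w)
  sumᴸ-weight P? w (x ∷ xs) with P? x
  ... | yes _ = trans (+-congˡ (sumᴸ-weight P? w xs))
    (solve 2 (λ w k → w :+ k :* w := (con (+ 1) :+ k) :* w) refl w (fromℕ (length (filter P? xs))))
  ... | no  _ = trans (+-identityˡ _) (sumᴸ-weight P? w xs)

  -- A minimum over finitely many values, found by comparisons that are available only under double
  -- negation. Going below each positive value first makes the bound strict. It provides one radius
  -- for the small squares around all vertices.
  ¬¬-separation : ∀ {a} {A : Set a} (f : A → Carrier) xs →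
                  ¬ ¬ (∃[ ε ] 0# < ε × All (λ x → 0# < f x → ε < f x) xs)
  ¬¬-separation f []       k = k (1# , 0<1 , [])
  ¬¬-separation f (x ∷ xs) k = ¬¬-separation f xs λ (ε , 0<ε , sep) →
    ¬¬-excluded-middle λ where
      (no  fx≤0) → k (ε , 0<ε , (λ 0<fx → ⊥-elim (fx≤0 0<fx)) ∷ sep)
      (yes 0<fx) → let (δ , 0<δ , δ<fx) = smaller-positive 0<fx in
        ¬¬-excluded-middle {A = δ < ε} λ where
          (yes δ<ε) → k (δ , 0<δ , (λ _ → δ<fx) ∷ All.map (λ s 0<fy → <-trans δ<ε (s 0<fy)) sep)
          (no  ε≤δ) → k (ε , 0<ε , (λ _ → ≤-<-trans ε≤δ δ<fx) ∷ sep)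

  -- Covering intervals and points by consecutive intervals.

  module _ {w : Carrier} where

    Breakpoints : (ℕ → Carrier) → Set ℓ₂
    Breakpoints lo = ∀ i → lo (suc i) ≤ lo i + w

    -- An interval between consecutive breakpoints covers at most `w` of the stretch from `a` to
    -- `b`, and pays at least `w` if it meets that stretch. The induction removes the first
    -- interval: the stretch ends in it, crosses `lo 1`, or lies beyond it.
    cover-interval :
      ∀ {k lo} → Breakpoints lo → (h : Fin k → Carrier) → (∀ i → 0# ≤ h i) → ∀ {a b} →
      a ≤ b → lo 0 ≤ a → b ≤ lo k →
      (∀ i x → a ≤ x → x ≤ b → lo (toℕ i) ≤ x → x ≤ lo (suc (toℕ i)) → w ≤ h i) →
      b - a ≤ sum h
    cover-interval {zero} {lo} step h 0≤h {a} {b} a≤b lo≤a b≤lo hit = begin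
      b - a  ≤⟨ +-monoˡ-≤ (- a) (≤-trans b≤lo lo≤a) ⟩
      a - a  ≈⟨ -‿inverseʳ a ⟩
      0#     ∎
      where open ≤-Reasoning
    cover-interval {suc k} {lo} step h 0≤h {a} {b} a≤b lo≤a b≤lo hit =
      ≤-total b (lo 1)
        (λ b≤lo₁ → begin
          b - a             ≤⟨ first-cell b≤lo₁ ⟩
          w                 ≤⟨ hit zero a ≤-refl a≤b lo≤a (≤-trans a≤b b≤lo₁) ⟩
          h zero            ≤⟨ x≤x+y 0≤tail ⟩
          sum h             ∎)
        (λ lo₁≤b → ≤-total a (lo 1)
          (λ a≤lo₁ → begin
            b - a
              ≈⟨ solve 3 (λ a b l → b :- a := (l :- a) :+ (b :- l)) refl a b (lo 1) ⟩
            (lo 1 - a) + (b - lo 1)  ≤⟨ +-mono-≤ (first-cell ≤-refl) ≤-refl ⟩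
            w + (b - lo 1)
              -- The stretch is cut at `lo 1`: the first interval pays for the part up to `lo 1`,
              -- the remaining ones for the part from there to `b`.
              ≤⟨ +-mono-≤ (hit zero a ≤-refl a≤b lo≤a a≤lo₁)
                   (cover-interval {k} (λ i → step (suc i)) _ (λ i → 0≤h (suc i)) lo₁≤b ≤-refl b≤lo
                     (λ i x lo₁≤x → hit (suc i) x (≤-trans a≤lo₁ lo₁≤x))) ⟩
            sum h                    ∎)
          (λ lo₁≤a → begin
            b - a
              ≤⟨ cover-interval {k} (λ i → step (suc i)) _ (λ i → 0≤h (suc i)) a≤b lo₁≤a b≤lo
                   (λ i → hit (suc i)) ⟩
            sum (λ i → h (suc i))
              ≤⟨ y≤x+y (0≤h zero) ⟩
            sum h  ∎))
      where
      open ≤-Reasoning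
      0≤tail : 0# ≤ sum (λ i → h (suc i))
      0≤tail = sum-nonNeg _ (λ i → 0≤h (suc i))
      first-cell : ∀ {x} → x ≤ lo 1 → x - a ≤ w
      first-cell {x} x≤lo₁ = begin
        x - a            ≤⟨ +-monoˡ-≤ (- a) (≤-trans x≤lo₁ (step 0)) ⟩
        (lo 0 + w) - a   ≤⟨ +-monoˡ-≤ (- a) (+-monoˡ-≤ w lo≤a) ⟩
        (a + w) - a      ≈⟨ solve 2 (λ a w → (a :+ w) :- a := w) refl a w ⟩
        w                ∎

  cover-point :
    ∀ {k} (lo : ℕ → Carrier) (h : Fin (suc k) → Carrier) → (∀ i → 0# ≤ h i) → ∀ {w y} →
    lo 0 ≤ y → y ≤ lo (suc k) →
    (∀ i → lo (toℕ i) ≤ y → y ≤ lo (suc (toℕ i)) → w ≤ h i) →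
    w ≤ sum h
  cover-point {zero} lo h 0≤h lo≤y y≤lo hit = ≤-trans (hit zero lo≤y y≤lo) (x≤x+y ≤-refl)
  cover-point {suc k} lo h 0≤h {y = y} lo≤y y≤lo hit = ≤-total y (lo 1)
    (λ y≤lo₁ → ≤-trans (hit zero lo≤y y≤lo₁) (x≤x+y (sum-nonNeg _ (λ i → 0≤h (suc i)))))
    (λ lo₁≤y → ≤-trans
      (cover-point (λ i → lo (suc i)) (λ i → h (suc i)) (λ i → 0≤h (suc i)) lo₁≤y y≤lo
        (λ i → hit (suc i)))
      (y≤x+y (0≤h zero)))

-- Finite choice under double negation: finitely many case distinctions can be assumed
-- simultaneously.
¬¬-sequence : ∀ {n p} {P : Fin n → Set p} → (∀ i → ¬ ¬ P i) → ¬ ¬ (∀ i → P i)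
¬¬-sequence = Fin.sequence (RawMonad.rawApplicative ¬¬-Monad)

-- Distances and segments in the plane.

module PlaneProperties {c ℓ₁ ℓ₂} (R : Reals c ℓ₁ ℓ₂) where

  open Reals R hiding (zero)
  open Plane R
  open OrderedFieldProperties orderedField

  √-≤ : ∀ {x y} → 0# ≤ x → 0# ≤ y → x ≤ y * y → √ x ≤ y
  √-≤ 0≤x 0≤y x≤y² = square-cancel 0≤y (≤-trans (≤-reflexive (√-squared 0≤x)) x≤y²)

  squares-nonNeg : ∀ u v → 0# ≤ u * u + v * v
  squares-nonNeg u v = +-nonNeg (square-nonNeg u) (square-nonNeg v)

  -- Euclidean distance is at most Manhattan distance, because (A + B)² exceeds A² + B² by 2AB ≥ 0.
  dist-≤ : ∀ {x₁ y₁ x₂ y₂ A B} → 0# ≤ A → 0# ≤ B →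
           x₁ - x₂ ≤ A → x₂ - x₁ ≤ A → y₁ - y₂ ≤ B → y₂ - y₁ ≤ B →
           dist (x₁ , y₁) (x₂ , y₂) ≤ A + B
  dist-≤ {x₁} {y₁} {x₂} {y₂} {A} {B} 0≤A 0≤B x≤A -x≤A y≤B -y≤B =
    √-≤ (squares-nonNeg _ _) (+-nonNeg 0≤A 0≤B) (begin
      (x₁ - x₂) * (x₁ - x₂) + (y₁ - y₂) * (y₁ - y₂)
        ≤⟨ +-mono-≤ (square-mono x≤A (flip-≤ -x≤A)) (square-mono y≤B (flip-≤ -y≤B)) ⟩
      A * A + B * B
        ≤⟨ x≤x+y (+-nonNeg (*-nonNeg 0≤A 0≤B) (*-nonNeg 0≤A 0≤B)) ⟩
      (A * A + B * B) + (A * B + A * B)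
        ≈⟨ solve 2 (λ a b → (a :* a :+ b :* b) :+ (a :* b :+ a :* b) := (a :+ b) :* (a :+ b))
             refl A B ⟩
      (A + B) * (A + B) ∎)
    where
    open ≤-Reasoning
    flip-≤ : ∀ {u v z} → v - u ≤ z → - (u - v) ≤ z
    flip-≤ {u} {v} = ≤-trans (≤-reflexive (solve 2 (λ u v → :- (u :- v) := v :- u) refl u v))

  start-∈ : ∀ p q → p ∈ₗ [ p , q ]
  start-∈ p q = 0# , (≤-refl , 0≤1) , at-0 _ _ , at-0 _ _
    where
    at-0 : ∀ x y → x ≈ x + 0# * (y - x)
    at-0 x y = solve 2 (λ x y → x := x :+ con (+ 0) :* (y :- x)) refl x y

  end-∈ : ∀ p q → q ∈ₗ [ p , q ]
  end-∈ p q = 1# , (0≤1 , ≤-refl) , at-1 _ _ , at-1 _ _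
    where
    at-1 : ∀ x y → y ≈ x + 1# * (y - x)
    at-1 x y = solve 2 (λ x y → y := x :+ con (+ 1) :* (y :- x)) refl x y

  reverse-∈ : ∀ {p q z} → z ∈ₗ [ q , p ] → z ∈ₗ [ p , q ]
  reverse-∈ (t , (0≤t , t≤1) , x≈ , y≈) =
    1# - t
    , (x≤y⇒0≤y-x t≤1
    , 0≤y-x⇒x≤y (≤-trans 0≤t (≤-reflexive
        (solve 1 (λ t → t := con (+ 1) :- (con (+ 1) :- t)) refl t))))
    , trans x≈ (reparametrise _ _) , trans y≈ (reparametrise _ _)
    where
    reparametrise : ∀ u v → v + t * (u - v) ≈ u + (1# - t) * (v - u)
    reparametrise u v = solve 3 (λ t u v →
      v :+ t :* (u :- v) := u :+ (con (+ 1) :- t) :* (v :- u)) refl t u v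

  transpose : Point → Point
  transpose (x , y) = y , x

  transpose-∈ : ∀ {p q z} → z ∈ₗ [ transpose p , transpose q ] → transpose z ∈ₗ [ p , q ]
  transpose-∈ (t , t∈ , x≈ , y≈) = t , t∈ , y≈ , x≈

  -- The parameter is (x - a) / (b - a); the strict `a < b` makes the denominator invertible.
  abscissa-∈ : ∀ {a a′ b b′ x} → a < b → a ≤ x → x ≤ b →
               ∃[ y ] (x , y) ∈ₗ [ (a , a′) , (b , b′) ]
  abscissa-∈ {a} {a′} {b} {b′} {x} a<b a≤x x≤b = at (inverse (x<y⇒0<y-x a<b))
    where
    open ≤-Reasoning
    at : ∃[ i ] 0# < i × (b - a) * i ≈ 1# → ∃[ y ] (x , y) ∈ₗ [ (a , a′) , (b , b′) ]
    at (i , 0<i , [b-a]i≈1) = a′ + t * (b′ - a′) , t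
      , (*-nonNeg (x≤y⇒0≤y-x a≤x) (<⇒≤ 0<i) , t≤1) , x≈ , refl
      where
      t : Carrier
      t = (x - a) * i
      t≤1 : t ≤ 1#
      t≤1 = begin
        (x - a) * i  ≤⟨ *-monoˡ-≤ i (<⇒≤ 0<i) (+-monoˡ-≤ (- a) x≤b) ⟩
        (b - a) * i  ≈⟨ [b-a]i≈1 ⟩
        1#           ∎
      x≈ : x ≈ a + t * (b - a)
      x≈ = begin-equality
        x                              ≈⟨ solve 2 (λ a x → x := a :+ (x :- a) :* con (+ 1)) refl a x ⟩
        a + (x - a) * 1#               ≈⟨ +-congˡ (*-congˡ [b-a]i≈1) ⟨
        a + (x - a) * ((b - a) * i)
          ≈⟨ solve 4 (λ a b x i → a :+ (x :- a) :* ((b :- a) :* i) := a :+ ((x :- a) :* i) :* (b :- a))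
               refl a b x i ⟩
        a + ((x - a) * i) * (b - a)    ∎

  -- Two points with parameters `t` and `u` differ by the vector of the segment scaled by `t - u` up
  -- to sign, and |t - u| ≤ 1 as both parameters lie between 0 and 1.
  dist-≤-len : ∀ {p q s} → p ∈ₗ s → q ∈ₗ s → dist p q ≤ len s
  dist-≤-len {xp , yp} {xq , yq} {[ (x₁ , y₁) , (x₂ , y₂) ]}
    (t , (0≤t , t≤1) , xp≈ , yp≈) (u , (0≤u , u≤1) , xq≈ , yq≈) =
    √-≤ (squares-nonNeg _ _) (√-nonNeg (squares-nonNeg _ _)) (begin
      (xp - xq) * (xp - xq) + (yp - yq) * (yp - yq)
        ≈⟨ +-cong (*-cong (diff xp≈ xq≈) (diff xp≈ xq≈))
                  (*-cong (diff yp≈ yq≈) (diff yp≈ yq≈)) ⟩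
      (- (t - u) * (x₁ - x₂)) * (- (t - u) * (x₁ - x₂))
      + (- (t - u) * (y₁ - y₂)) * (- (t - u) * (y₁ - y₂))
        ≈⟨ solve 3 (λ t x y → (:- t :* x) :* (:- t :* x) :+ (:- t :* y) :* (:- t :* y)
                            := (t :* t) :* (x :* x :+ y :* y)) refl (t - u) (x₁ - x₂) (y₁ - y₂) ⟩
      ((t - u) * (t - u)) * D
        ≤⟨ *-monoˡ-≤ D (squares-nonNeg _ _)
             (square-mono (≤-trans (t-u≤t 0≤u) t≤1)
               (≤-trans (≤-reflexive (solve 2 (λ t u → :- (t :- u) := u :- t) refl t u))
                 (≤-trans (t-u≤t 0≤t) u≤1))) ⟩
      (1# * 1#) * D
        ≈⟨ solve 1 (λ d → (con (+ 1) :* con (+ 1)) :* d := d) refl D ⟩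
      D
        ≈⟨ √-squared (squares-nonNeg _ _) ⟨
      √ D * √ D ∎)
    where
    open ≤-Reasoning
    D : Carrier
    D = (x₁ - x₂) * (x₁ - x₂) + (y₁ - y₂) * (y₁ - y₂)
    diff : ∀ {a b v w} → a ≈ v + t * (w - v) → b ≈ v + u * (w - v) → a - b ≈ - (t - u) * (v - w)
    diff {v = v} {w} a≈ b≈ = trans (+-cong a≈ (-‿cong b≈))
      (solve 4 (λ t u v w → (v :+ t :* (w :- v)) :- (v :+ u :* (w :- v)) := :- (t :- u) :* (v :- w))
        refl t u v w)
    t-u≤t : ∀ {t u} → 0# ≤ u → t - u ≤ t
    t-u≤t {t} {u} 0≤u = begin
      t - u      ≤⟨ x≤x+y 0≤u ⟩
      t - u + u  ≈⟨ solve 2 (λ t u → t :- u :+ u := t) refl t u ⟩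
      t          ∎

  -- The length of a segment against the grid cells it meets.

  module _ (k : ℕ) (w : Carrier) where

    Weights : Set c
    Weights = Fin (suc k) → Fin (suc k) → Carrier

    total : Weights → Carrier
    total h = sum (λ i → sum (h i))

    Covers : (loX loY : ℕ → Carrier) → Segment → Set (c ⊔ ℓ₁ ⊔ ℓ₂)
    Covers loX loY s = ∀ {x y} → (x , y) ∈ₗ s →
      (loX 0 ≤ x × x ≤ loX (suc k)) × (loY 0 ≤ y × y ≤ loY (suc k))

    -- Cells are closed, so a point on a common side charges every cell that contains it and no
    -- point falls between cells.
    Charges : (loX loY : ℕ → Carrier) → Weights → Segment → Set (c ⊔ ℓ₁ ⊔ ℓ₂)
    Charges loX loY h s = ∀ i j {x y} → (x , y) ∈ₗ s →
      loX (toℕ i) ≤ x → x ≤ loX (suc (toℕ i)) →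
      loY (toℕ j) ≤ y → y ≤ loY (suc (toℕ j)) → w ≤ h i j

    -- Above each abscissa of the extent lies a point of the segment, which falls into some row. So
    -- every column met by the extent has sum at least `w`, and these columns cover the extent. If
    -- `q` is not to the right of `p`, the left side is at most 0.
    x-extent-≤ :
      ∀ loX loY → Breakpoints {w} loX → (h : Weights) → (∀ i j → 0# ≤ h i j) → ∀ {p q} →
      Covers loX loY [ p , q ] → Charges loX loY h [ p , q ] →
      proj₁ q - proj₁ p ≤ total h
    x-extent-≤ loX loY step h 0≤h {p} {q} covers charges = ≤-cases (proj₁ p < proj₁ q)
      (λ a<b → cover-interval step (λ i → sum (h i)) 0≤column (<⇒≤ a<b)
        (proj₁ (proj₁ (covers (start-∈ p q)))) (proj₂ (proj₁ (covers (end-∈ p q))))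
        (λ i x a≤x x≤b above below → let (y , z∈) = abscissa-∈ a<b a≤x x≤b in
          cover-point loY (h i) (0≤h i) (proj₁ (proj₂ (covers z∈))) (proj₂ (proj₂ (covers z∈)))
            (λ j → charges i j z∈ above below)))
      (λ b≤a → begin
        proj₁ q - proj₁ p  ≤⟨ +-monoˡ-≤ _ b≤a ⟩
        proj₁ p - proj₁ p  ≈⟨ -‿inverseʳ _ ⟩
        0#                 ≤⟨ sum-nonNeg _ 0≤column ⟩
        total h            ∎)
      where
      open ≤-Reasoning
      0≤column : ∀ i → 0# ≤ sum (h i)
      0≤column i = sum-nonNeg (h i) (0≤h i)

    -- One `total h` pays for each coordinate extent. Reversing the segment gives the opposite sign
    -- of a difference; transposing the plane turns the bound for x into the one for y, with rows
    -- and columns summed in the other order.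
    len-≤-grid :
      ∀ loX loY → Breakpoints {w} loX → Breakpoints {w} loY →
      (h : Weights) → (∀ i j → 0# ≤ h i j) → ∀ s →
      Covers loX loY s → Charges loX loY h s → len s ≤ total h + total h
    len-≤-grid loX loY stepX stepY h 0≤h [ p , q ] covers charges = dist-≤ 0≤total 0≤total
      (x-extent-≤ loX loY stepX h 0≤h (λ z∈ → covers (reverse-∈ z∈))
        (λ i j z∈ → charges i j (reverse-∈ z∈)))
      (x-extent-≤ loX loY stepX h 0≤h covers charges)
      (≤-trans (x-extent-≤ loY loX stepY hᵀ (λ j i → 0≤h i j)
          (λ z∈ → swap (covers (reverse-∈ (transpose-∈ z∈))))
          (λ j i z∈ y≥ y≤ x≥ x≤ → charges i j (reverse-∈ (transpose-∈ z∈)) x≥ x≤ y≥ y≤))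
        (≤-reflexive (∑-comm hᵀ)))
      (≤-trans (x-extent-≤ loY loX stepY hᵀ (λ j i → 0≤h i j)
          (λ z∈ → swap (covers (transpose-∈ z∈)))
          (λ j i z∈ y≥ y≤ x≥ x≤ → charges i j (transpose-∈ z∈) x≥ x≤ y≥ y≤))
        (≤-reflexive (∑-comm hᵀ)))
      where
      hᵀ : Weights
      hᵀ j i = h i j
      0≤total : 0# ≤ total h
      0≤total = sum-nonNeg _ (λ i → sum-nonNeg _ (0≤h i))

  -- Subdivision of a square into equal cells.

  module Grid (S : Square) (k : ℕ) where

    private
      r = radius S
      M = fromℕ (suc k)
      M⁻¹ = inverse (+-pos 0<1 (fromℕ-nonNeg k))

    -- The cell radius r / M is kept opaque; what follows rests on `ρ-pos` and `M*ρ≈r`.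
    abstract
      ρ : Carrier
      ρ = r * proj₁ M⁻¹

      ρ-pos : 0# < ρ
      ρ-pos = *-pos (radius-pos S) (proj₁ (proj₂ M⁻¹))

      M*ρ≈r : M * ρ ≈ r
      M*ρ≈r = begin-equality
        M * (r * proj₁ M⁻¹)
          ≈⟨ solve 3 (λ m r i → m :* (r :* i) := r :* (m :* i)) refl M r (proj₁ M⁻¹) ⟩
        r * (M * proj₁ M⁻¹)  ≈⟨ *-congˡ (proj₂ (proj₂ M⁻¹)) ⟩
        r * 1#               ≈⟨ *-identityʳ r ⟩
        r                    ∎
        where open ≤-Reasoning

    w : Carrier
    w = ρ + ρ

    w-nonNeg : 0# ≤ w
    w-nonNeg = +-nonNeg (<⇒≤ ρ-pos) (<⇒≤ ρ-pos)

    -- Here `a` is either coordinate of the centre, so one formula gives the vertical and the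
    -- horizontal grid lines, starting at a side of `S`.
    breakpoint : Carrier → ℕ → Carrier
    breakpoint a i = a - r + fromℕ i * w

    breakpoint-suc : ∀ a i → breakpoint a (suc i) ≈ breakpoint a i + w
    breakpoint-suc a i = solve 3 (λ x n w → x :+ (con (+ 1) :+ n) :* w := x :+ n :* w :+ w)
      refl (a - r) (fromℕ i) w

    breakpoint-first : ∀ a → breakpoint a 0 ≈ a - r
    breakpoint-first a = solve 2 (λ x w → x :+ con (+ 0) :* w := x) refl (a - r) w

    breakpoint-last : ∀ a → breakpoint a (suc k) ≈ a + r
    breakpoint-last a = begin-equality
      a - r + M * w
        ≈⟨ solve 4 (λ a r m p → a :- r :+ m :* (p :+ p) := a :- r :+ (m :* p :+ m :* p)) refl a r M ρ ⟩
      a - r + (M * ρ + M * ρ)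
        ≈⟨ +-congˡ (+-cong M*ρ≈r M*ρ≈r) ⟩
      a - r + (r + r)
        ≈⟨ solve 2 (λ a r → a :- r :+ (r :+ r) := a :+ r) refl a r ⟩
      a + r ∎
      where open ≤-Reasoning

    breakpoints : ∀ a → Breakpoints {w} (breakpoint a)
    breakpoints a i = ≤-reflexive (breakpoint-suc a i)

    lower : ∀ a {x} → a - r ≤ x → breakpoint a 0 ≤ x
    lower a = ≤-trans (≤-reflexive (breakpoint-first a))

    upper : ∀ a {x} → x ≤ a + r → x ≤ breakpoint a (suc k)
    upper a x≤ = ≤-trans x≤ (≤-reflexive (sym (breakpoint-last a)))

    midpoint : Carrier → ℕ → Carrier
    midpoint a i = breakpoint a i + ρ

    midpoint-lower : ∀ a i {x} → breakpoint a i ≤ x → midpoint a i - ρ ≤ x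
    midpoint-lower a i = ≤-trans (≤-reflexive
      (solve 2 (λ x p → x :+ p :- p := x) refl (breakpoint a i) ρ))

    midpoint-upper : ∀ a i {x} → x ≤ breakpoint a (suc i) → x ≤ midpoint a i + ρ
    midpoint-upper a i x≤ = ≤-trans x≤ (≤-reflexive
      (trans (breakpoint-suc a i) (sym (+-assoc (breakpoint a i) ρ ρ))))

    cell : Fin (suc k) → Fin (suc k) → Square
    cell i j = record
      { centre     = midpoint (proj₁ (centre S)) (toℕ i) , midpoint (proj₂ (centre S)) (toℕ j)
      ; radius     = ρ
      ; radius-pos = ρ-pos
      }

    -- The grid bound is applied to the clipped segment `s′`, which stays inside `S` and hence
    -- inside the grid. Its points belong to `s`, so a cell met by `s′` is also met by `s`.
    clipped-≤-grid :
      ∀ {s ℓ} → ClippedLength s S ℓ → (h : Weights k w) → (∀ i j → 0# ≤ h i j) →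
      (∀ i j → s Intersects cell i j → w ≤ h i j) → ℓ ≤ total k w h + total k w h
    clipped-≤-grid (disjoint _ ℓ≈0) h 0≤h hit =
      ≤-trans (≤-reflexive ℓ≈0) (+-nonNeg 0≤total 0≤total)
      where
      0≤total : 0# ≤ total k w h
      0≤total = sum-nonNeg _ (λ i → sum-nonNeg _ (0≤h i))
    clipped-≤-grid {s} (clipped s′ s′⇔ ℓ≈) h 0≤h hit = ≤-trans (≤-reflexive ℓ≈)
      (len-≤-grid k w (breakpoint a) (breakpoint b) (breakpoints a) (breakpoints b) h 0≤h s′
        covers charges)
      where
      a = proj₁ (centre S)
      b = proj₂ (centre S)
      covers : Covers k w (breakpoint a) (breakpoint b) s′
      covers z∈s′ with Equivalence.to (s′⇔ _) z∈s′
      ... | _ , (x≥ , x≤) , (y≥ , y≤) = (lower a x≥ , upper a x≤) , (lower b y≥ , upper b y≤)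
      charges : Charges k w (breakpoint a) (breakpoint b) h s′
      charges i j z∈s′ x≥ x≤ y≥ y≤ = hit i j (_ , proj₁ (Equivalence.to (s′⇔ _) z∈s′) ,
        (midpoint-lower a (toℕ i) x≥ , midpoint-upper a (toℕ i) x≤) ,
        (midpoint-lower b (toℕ j) y≥ , midpoint-upper b (toℕ j) y≤))

  clipped-≤-len : ∀ {s S ℓ} → ClippedLength s S ℓ → ℓ ≤ len s
  clipped-≤-len (disjoint _ ℓ≈0) = ≤-trans (≤-reflexive ℓ≈0) (√-nonNeg (squares-nonNeg _ _))
  clipped-≤-len (clipped [ p , q ] s′⇔ ℓ≈) = ≤-trans (≤-reflexive ℓ≈)
    (dist-≤-len (proj₁ (Equivalence.to (s′⇔ p) (start-∈ p q)))
                (proj₁ (Equivalence.to (s′⇔ q) (end-∈ p q))))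

  -- Charging edges to cells and vertices.

  module _ {n : ℕ} (G : GeometricGraph n) {d : Carrier} (lowDensity : LowDensity G d) where

    open GeometricGraph G

    Edge : Set
    Edge = Fin n × Fin n

    Dense : Square → Edge → Set (c ⊔ ℓ₁ ⊔ ℓ₂)
    Dense S e = radius S < len (segment e) × segment e Intersects S

    ¬¬-dense? : ∀ S → ¬ ¬ (∀ e → Dec (Dense S e))
    ¬¬-dense? S = ¬¬-map (λ D (u , v) → D u v)
      (¬¬-sequence (λ u → ¬¬-sequence (λ v → ¬¬-excluded-middle)))

    -- Low density is applied to the empty set of edges.
    density-≥0 : Square → 0# ≤ d
    density-≥0 S = lowDensity S [] (minimum edges) []

    sumᴸ-dense-≤ : ∀ S (dense? : ∀ e → Dec (Dense S e)) {w} → 0# ≤ w →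
                   sumᴸ (λ e → weight (dense? e) w) edges ≤ d * w
    sumᴸ-dense-≤ S dense? {w} 0≤w = ≤-trans (≤-reflexive (sumᴸ-weight dense? w edges))
      (*-monoˡ-≤ w 0≤w (lowDensity S (filter dense? edges) (filter-⊆ dense? edges)
        (All.all-filter dense? edges)))

    vertex-square : ∀ {ε} → 0# < ε → Fin n → Square
    vertex-square {ε} 0<ε v = record { centre = position v ; radius = ε ; radius-pos = 0<ε }

    meets-vertex-square : ∀ {ε} (0<ε : 0# < ε) u v → segment (u , v) Intersects vertex-square 0<ε u
    meets-vertex-square {ε} 0<ε u v = position u , start-∈ _ _ , near _ , near _
      where
      near : ∀ x → x - ε ≤ x × x ≤ x + ε
      near x = ≤-trans (x≤x+y (<⇒≤ 0<ε)) (≤-reflexive (solve 2 (λ x e → x :- e :+ e := x) refl x ε))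
             , x≤x+y (<⇒≤ 0<ε)

    module _ (S : Square) (ℓ : Edge → Carrier)
             (clip : All (λ e → ClippedLength (segment e) S (ℓ e)) edges) (k : ℕ) where

      open Grid S k

      private
        M = fromℕ (suc k)
        N = fromℕ n

      -- Each of the M² cells is charged `w` by at most `d` edges, and this counts twice, once per
      -- coordinate extent. Each of the `n` vertices is charged `ρ` by at most `d` edges.
      sum-clipped-≤ : sumᴸ ℓ edges ≤ M * (M * (d * w)) + M * (M * (d * w)) + N * (d * ρ)
      sum-clipped-≤ =
        -- The radius `ε` and the decisions for all cells and all vertex squares exist only up to
        -- double negation, which suffices for an inequality.
        ≤-stable (¬¬-separation (λ e → len (segment e)) edges) λ (ε , 0<ε , separated) →
        ≤-stable (¬¬-sequence (λ i → ¬¬-sequence (λ j → ¬¬-dense? (cell i j)))) λ cell? →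
        ≤-stable (¬¬-sequence (λ v → ¬¬-dense? (vertex-square 0<ε v))) λ vertex? →
        bound 0<ε separated cell? vertex?
        where
        open ≤-Reasoning
        0≤ρ = <⇒≤ ρ-pos
        bound : ∀ {ε} (0<ε : 0# < ε) →
                All (λ e → 0# < len (segment e) → ε < len (segment e)) edges →
                (∀ i j e → Dec (Dense (cell i j) e)) →
                (∀ v e → Dec (Dense (vertex-square 0<ε v) e)) →
                sumᴸ ℓ edges ≤ M * (M * (d * w)) + M * (M * (d * w)) + N * (d * ρ)
        bound {ε} 0<ε separated cell? vertex? = begin
          sumᴸ ℓ edges
            ≤⟨ sumᴸ-mono (All.zipWith (λ {e} → charge e) (clip , separated)) ⟩
          sumᴸ (λ e → A e + A e + B e) edges
            ≈⟨ trans (sumᴸ-+ (λ e → A e + A e) B edges) (+-congʳ (sumᴸ-+ A A edges)) ⟩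
          sumᴸ A edges + sumᴸ A edges + sumᴸ B edges
            ≤⟨ +-mono-≤ (+-mono-≤ sumA≤ sumA≤) sumB≤ ⟩
          M * (M * (d * w)) + M * (M * (d * w)) + N * (d * ρ) ∎
          where
          h : Edge → Weights k w
          h e i j = weight (cell? i j e) w
          0≤h : ∀ e i j → 0# ≤ h e i j
          0≤h e i j = weight-nonNeg (cell? i j e) w-nonNeg
          g : Edge → Fin n → Carrier
          g e v = weight (vertex? v e) ρ
          0≤g : ∀ e v → 0# ≤ g e v
          0≤g e v = weight-nonNeg (vertex? v e) 0≤ρ
          A B : Edge → Carrier
          A e = total k w (h e)
          B e = sum (g e)
          0≤A+A : ∀ e → 0# ≤ A e + A e
          0≤A+A e = +-nonNeg 0≤A 0≤A
            where
            0≤A : 0# ≤ A e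
            0≤A = sum-nonNeg _ (λ i → sum-nonNeg _ (0≤h e i))
          0≤B : ∀ e → 0# ≤ B e
          0≤B e = sum-nonNeg _ (0≤g e)
          charge : ∀ e → ClippedLength (segment e) S (ℓ e) ×
                   (0# < len (segment e) → ε < len (segment e)) → ℓ e ≤ A e + A e + B e
          -- Long edges are paid for by the cells they meet, short edges of positive length by a
          -- vertex, and edges of zero length by nothing.
          charge e@(u , v) (ℓe , separated) = ≤-cases (ρ < len (segment e))
            (λ ρ<len → ≤-trans
              (clipped-≤-grid ℓe (h e) (0≤h e)
                (λ i j meets → weight-true (cell? i j e) (ρ<len , meets)))
              (x≤x+y (0≤B e)))
            (λ len≤ρ → ≤-trans (clipped-≤-len ℓe) (≤-cases (0# < len (segment e))
              (λ 0<len → begin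
                len (segment e)  ≤⟨ len≤ρ ⟩
                ρ
                  -- A short edge is charged to its first endpoint alone; being longer than `ε`, it
                  -- counts in the small square there.
                  ≤⟨ weight-true (vertex? u e) (separated 0<len , meets-vertex-square 0<ε u v) ⟩
                g e u            ≤⟨ term≤sum (g e) (0≤g e) u ⟩
                B e              ≤⟨ y≤x+y (0≤A+A e) ⟩
                A e + A e + B e  ∎)
              (λ len≤0 → ≤-trans len≤0 (+-nonNeg (0≤A+A e) (0≤B e)))))
          sumA≤ : sumᴸ A edges ≤ M * (M * (d * w))
          sumA≤ = ≤-trans (≤-reflexive (sumᴸ-sum (λ i e → sum (h e i)) edges)) (sum-≤ _ λ i →
            ≤-trans (≤-reflexive (sumᴸ-sum (λ j e → h e i j) edges)) (sum-≤ _ λ j →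
            sumᴸ-dense-≤ (cell i j) (cell? i j) w-nonNeg))
          sumB≤ : sumᴸ B edges ≤ N * (d * ρ)
          sumB≤ = ≤-trans (≤-reflexive (sumᴸ-sum (λ v e → g e v) edges)) (sum-≤ _ λ v →
            sumᴸ-dense-≤ (vertex-square 0<ε v) (vertex? v) 0≤ρ)

      -- Here `s` is √n. As w = 2ρ, the cells give 4dM²ρ, and M = 1 + k ≤ 2s bounds this by 8ds(Mρ).
      -- The vertices give s²dρ ≤ ds(Mρ), by s ≤ M. With Mρ = r the sum is 9dsr.
      packed-bound : ∀ {s} → 0# ≤ s → s * s ≈ N → fromℕ k ≤ s → 1# ≤ s → s ≤ M →
                     sumᴸ ℓ edges ≤ fromℤ (+ 9) * d * s * radius S
      packed-bound {s} 0≤s s²≈N k≤s 1≤s s≤M = begin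
        sumᴸ ℓ edges
          ≤⟨ sum-clipped-≤ ⟩
        M * (M * (d * w)) + M * (M * (d * w)) + N * (d * ρ)
          ≈⟨ +-congˡ (*-congʳ s²≈N) ⟨
        M * (M * (d * w)) + M * (M * (d * w)) + s * s * (d * ρ)
          ≈⟨ solve 4 (λ m s d p →
               m :* (m :* (d :* (p :+ p))) :+ m :* (m :* (d :* (p :+ p))) :+ s :* s :* (d :* p)
               := con (+ 4) :* d :* (m :* p) :* m :+ (d :* s :* p) :* s) refl M s d ρ ⟩
        fromℤ (+ 4) * d * (M * ρ) * M + (d * s * ρ) * s
          ≤⟨ +-mono-≤
               (*-monoʳ-≤ _ (*-nonNeg (*-nonNeg 0≤4 0≤d) (*-nonNeg 0≤M 0≤ρ)) (+-mono-≤ 1≤s k≤s))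
               (*-monoʳ-≤ _ (*-nonNeg (*-nonNeg 0≤d 0≤s) 0≤ρ) s≤M) ⟩
        fromℤ (+ 4) * d * (M * ρ) * (s + s) + (d * s * ρ) * M
          ≈⟨ solve 4 (λ m s d p →
               con (+ 4) :* d :* (m :* p) :* (s :+ s) :+ (d :* s :* p) :* m
               := con (+ 9) :* d :* s :* (m :* p)) refl M s d ρ ⟩
        fromℤ (+ 9) * d * s * (M * ρ)
          ≈⟨ *-congˡ M*ρ≈r ⟩
        fromℤ (+ 9) * d * s * radius S ∎
        where
        open ≤-Reasoning
        0≤d = density-≥0 S
        0≤ρ = <⇒≤ ρ-pos
        0≤M = fromℕ-nonNeg (suc k)
        0≤4 : 0# ≤ fromℤ (+ 4)
        0≤4 = +-nonNeg (+-nonNeg (+-nonNeg 0≤1 0≤1) 0≤1) 0≤1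

-- The number of cells per side and the final bound.

√-bracket : ∀ n → ∃[ k ] k ℕ.* k ℕ.≤ n × n ℕ.≤ suc k ℕ.* suc k
√-bracket zero = 0 , ℕ.z≤n , ℕ.z≤n
√-bracket (suc n) with √-bracket n
... | k , k²≤n , n≤[1+k]² with suc n ℕ.≤? suc k ℕ.* suc k
...   | yes n+1≤ = k , ℕ.m≤n⇒m≤1+n k²≤n , n+1≤
-- Moving from `k` to `k + 1` is enough: n + 1 ≤ (k + 1)² + 1 ≤ (k + 2)².
...   | no  n+1≰ = suc k , ℕ.<⇒≤ (ℕ.≰⇒> n+1≰)
  , ℕ.≤-trans (ℕ.s≤s n≤[1+k]²) (ℕ.*-mono-< (ℕ.n<1+n (suc k)) (ℕ.n<1+n (suc k)))

lemma3 : ∀ {c ℓ₁ ℓ₂} (R : Reals c ℓ₁ ℓ₂) →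
    let open Reals R
        open Plane R
    in ∃[ C ] (0# < C ×
         (∀ (n : ℕ) (d : Carrier) (G : GeometricGraph n) →
            LowDensity G d → Packed G (C * d * √ (fromℕ n))))
lemma3 R = fromℤ (+ 9) , 0<9 , packed
  where
  open Reals R hiding (zero)
  open Plane R
  open OrderedFieldProperties orderedField
  open PlaneProperties R

  0<9 : 0# < fromℤ (+ 9)
  0<9 = +-pos (+-pos (+-pos (+-pos (+-pos (+-pos (+-pos (+-pos 0<1 0≤1) 0≤1) 0≤1) 0≤1) 0≤1) 0≤1) 0≤1) 0≤1

  packed : ∀ n d (G : GeometricGraph n) →
           LowDensity G d → Packed G (fromℤ (+ 9) * d * √ (fromℕ n))
  -- Here 1 ≤ √n, which packed-bound assumes, fails; but there are no edges.
  packed zero d G lowDensity S ℓ _ =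
    *-nonNeg (*-nonNeg (*-nonNeg (<⇒≤ 0<9) (density-≥0 G lowDensity S)) (√-nonNeg ≤-refl))
      (<⇒≤ (radius-pos S))
  packed n@(suc m) d G lowDensity S ℓ clip =
    let (k , k²≤n , n≤[1+k]²) = √-bracket n in
    packed-bound G lowDensity S ℓ clip k 0≤√n √n²≈n
      (k≤√n k k²≤n)
      -- `fromℕ 1` unfolds to `1# + 0#`, and 1 · 1 ≤ n holds because `n` is a successor.
      (≤-trans (≤-reflexive (sym (+-identityʳ 1#))) (k≤√n 1 (ℕ.s≤s ℕ.z≤n)))
      (square-cancel (fromℕ-nonNeg (suc k)) (begin
        √ (fromℕ n) * √ (fromℕ n)          ≈⟨ √n²≈n ⟩
        fromℕ n                            ≤⟨ fromℕ-mono-≤ n≤[1+k]² ⟩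
        fromℕ (suc k ℕ.* suc k)            ≈⟨ fromℕ-* (suc k) (suc k) ⟩
        fromℕ (suc k) * fromℕ (suc k)      ∎))
    where
    open ≤-Reasoning
    0≤√n : 0# ≤ √ (fromℕ n)
    0≤√n = √-nonNeg (fromℕ-nonNeg n)
    √n²≈n : √ (fromℕ n) * √ (fromℕ n) ≈ fromℕ n
    √n²≈n = √-squared (fromℕ-nonNeg n)
    k≤√n : ∀ k → k ℕ.* k ℕ.≤ n → fromℕ k ≤ √ (fromℕ n)
    k≤√n k k²≤n = square-cancel 0≤√n (begin
      fromℕ k * fromℕ k          ≈⟨ fromℕ-* k k ⟨
      fromℕ (k ℕ.* k)            ≤⟨ fromℕ-mono-≤ k²≤n ⟩
      fromℕ n                    ≈⟨ √n²≈n ⟨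
      √ (fromℕ n) * √ (fromℕ n)  ∎)
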